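{- Let $\mathcal{P}$ be a regular $n$-polytope with automorphism group $W=\langle s_0,\dots,s_{n-1}\rangle$. Let $\mathcal{Q}=\mathcal{P}/N$ be a quotient of $\mathcal{P}$ admitting the flag action of $W$, with base flag $\Psi$ chosen so that $N$ is the stabilizer of $\Psi$ in $W$. Let $\mathcal{R}$ be a regular $d$-polytope (where $d$ need not equal $n$) with $\mathrm{Aut}(\mathcal{R})=\langle\rho_0,\dots,\rho_{d-1}\rangle$, and let $\phi:\mathrm{Aut}(\mathcal{R})\to\mathrm{Aut}(\mathcal{Q})$ be a group isomorphism. For each $i$ let $\nu_i\in W$ be an element with $\Psi^{\nu_i}=\Psi(\rho_i\phi)$, and let $V=\langle\nu_0,\dots,\nu_{d-1}\rangle\le W$. Define $\psi$ from words in the $\rho_i$ to $W$ by $(\rho_{i_1}\rho_{i_2}\cdots\rho_{i_k})\psi=\nu_{i_k}\cdots\nu_{i_2}\nu_{i_1}$. Then $N\cap V$ equals the set of all elements $w\psi$, where $w$ ranges over words in the $\rho_i$ such that $w=1$ as an element of $\mathrm{Aut}(\mathcal{R})$.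
   Context: Abstract polytopes are graded posets with least and greatest faces, all flags of equal length, strongly connected, satisfying the diamond condition; a polytope is regular if its automorphism group is transitive on flags, and its automorphism group is then a string C-group generated by involutions $\rho_0,\dots,\rho_{d-1}$ (resp. $s_0,\dots,s_{n-1}$). The flag action of $W$ on the flags of $\mathcal{Q}$ is the right action in which $s_i$ sends a flag $\Phi$ to the unique flag $\Phi^{s_i}$ differing from $\Phi$ only in its face of rank $i$ (assumed well defined), with $\Phi^{vw}=(\Phi^{v})^{w}$. Automorphisms act on flags on the right, written $\Psi\alpha$, with $\Psi(\alpha\beta)=(\Psi\alpha)\beta$, and they commute with the flag action. $\mathcal{P}/N$ is the quotient of $\mathcal{P}$ by the subgroup $N\le W$.
   Formalization: Words in the ρ_i may also contain inverse letters, with ρ_i⁻¹ sent to ν_i⁻¹; with only positive words the claim fails when some ν_i has infinite order, since the elements wψ would then form only a monoid and not the group N ∩ V. -}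

module Defs where

open import Algebra.Bundles using (Group)
open import Data.Fin.Base as Fin using (Fin; zero; suc; toℕ; fromℕ; inject₁)
import Data.Fin.Properties as Fin
open import Data.List.Base using (List; foldr; map; reverse)
open import Data.Nat.Base as ℕ using (ℕ; _+_; z≤n; s≤s)
import Data.Nat.Properties as ℕ
open import Data.Product.Base using (Σ-syntax; ∃-syntax; _×_; _,_; proj₁; proj₂)
open import Data.Sum.Base using (_⊎_)
open import Level using (Level; _⊔_) renaming (suc to lsuc)
open import Relation.Binary.Bundles using (Poset)
open import Relation.Binary.Construct.Closure.ReflexiveTransitive using (Star)
open import Relation.Binary.Core using (Rel; _Preserves_⟶_)
open import Relation.Binary.Morphism.Structures using (IsOrderIsomorphism)
import Relation.Binary.Morphism.Construct.Composition as Composition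
import Relation.Binary.Morphism.Construct.Identity as Identity
open import Relation.Binary.PropositionalEquality.Core as ≡ using (_≡_; _≢_)
import Relation.Binary.Properties.Poset as PosetProperties
open import Relation.Nullary.Negation.Core using (¬_)
open import Relation.Unary using (Pred)

------------------------------------------------------------------------
-- Subgroups and words

module _ {g ℓ} (G : Group g ℓ) where
  open Group G

  record Subgroup p : Set (g ⊔ ℓ ⊔ lsuc p) where
    field
      Member    : Pred Carrier p
      resp      : ∀ {x y} → x ≈ y → Member x → Member y
      ε-closed  : Member ε
      ∙-closed  : ∀ {x y} → Member x → Member y → Member (x ∙ y)
      ⁻¹-closed : ∀ {x} → Member x → Member (x ⁻¹)

  data Generated {I : Set} (a : I → Carrier) : Pred Carrier (g ⊔ ℓ) where
    generator : ∀ i → Generated a (a i)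
    ε-gen     : Generated a ε
    ∙-gen     : ∀ {x y} → Generated a x → Generated a y → Generated a (x ∙ y)
    ⁻¹-gen    : ∀ {x} → Generated a x → Generated a (x ⁻¹)
    ≈-gen     : ∀ {x y} → x ≈ y → Generated a x → Generated a y

-- Words are group words: each letter is a generator or a formal inverse.
-- Inverse letters matter when a word in involutions ρᵢ is sent to a word in
-- elements νᵢ, since the νᵢ need not be involutions and may have infinite
-- order.

data Letter (I : Set) : Set where
  _⁺ _⁻ : I → Letter I

Word : Set → Set
Word I = List (Letter I)

module _ {g ℓ} (G : Group g ℓ) {I : Set} (a : I → Group.Carrier G) where
  open Group G

  evalLetter : Letter I → Carrier
  evalLetter (i ⁺) = a i
  evalLetter (i ⁻) = a i ⁻¹

  eval : Word I → Carrier
  eval w = foldr _∙_ ε (map evalLetter w)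

  -- a i₁ ⋯ a iₖ is read as a iₖ ⋯ a i₁.
  evalReversed : Word I → Carrier
  evalReversed w = eval (reverse w)

------------------------------------------------------------------------
-- Graded posets

-- Ranks are shifted by one: the ranks -1, 0, …, n are represented by the
-- elements of Fin (2 + n).
--
-- rank-fill says that a chain can always be refined until it meets every
-- rank, and rank-injective that it meets each rank once; so the maximal chains
-- are the chains with exactly one face of each rank, and all of them have the
-- same length.  rank-injective is the positive form of strict monotonicity.

record GradedPoset (n : ℕ) c ℓ₁ ℓ₂ : Set (lsuc (c ⊔ ℓ₁ ⊔ ℓ₂)) where
  field
    poset : Poset c ℓ₁ ℓ₂

  open Poset poset public renaming (Carrier to Face)
  open PosetProperties poset public using (_<_)

  field
    rank           : Face → Fin (2 + n)
    rank-mono      : rank Preserves _≤_ ⟶ Fin._≤_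
    rank-injective : ∀ {x y} → x ≤ y → rank x ≡ rank y → x ≈ y
    rank-fill      : ∀ {x y} k → x ≤ y → rank x Fin.≤ k → k Fin.≤ rank y →
                     ∃[ z ] rank z ≡ k × x ≤ z × z ≤ y

    least          : Face
    least-≤        : ∀ x → least ≤ x
    rank-least     : rank least ≡ zero

    greatest       : Face
    ≤-greatest     : ∀ x → x ≤ greatest
    rank-greatest  : rank greatest ≡ fromℕ (1 + n)

  rank-cong : ∀ {x y} → x ≈ y → rank x ≡ rank y
  rank-cong x≈y =
    Fin.≤-antisym (rank-mono (reflexive x≈y)) (rank-mono (reflexive (Eq.sym x≈y)))

  record Flag : Set (c ⊔ ℓ₂) where
    field
      face      : Fin (2 + n) → Face
      rank-face : ∀ k → rank (face k) ≡ k
      face-mono : face Preserves Fin._≤_ ⟶ _≤_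

  open Flag public

  infix 4 _≈ᶠ_

  _≈ᶠ_ : Rel Flag ℓ₁
  Φ ≈ᶠ Φ′ = ∀ k → face Φ k ≈ face Φ′ k

  -- The position in a flag of the face of rank i, for 0 ≤ i < n.
  position : Fin n → Fin (2 + n)
  position i = suc (inject₁ i)

  AgreeOff : Fin n → Rel Flag ℓ₁
  AgreeOff i Φ Φ′ = ∀ k → k ≢ position i → face Φ k ≈ face Φ′ k

  Adjacent : Fin n → Rel Flag ℓ₁
  Adjacent i Φ Φ′ =
    AgreeOff i Φ Φ′ × ¬ face Φ (position i) ≈ face Φ′ (position i)

  Between : Face → Face → Set (c ⊔ ℓ₁ ⊔ ℓ₂)
  Between x y = Σ[ z ∈ Face ] x < z × z < y

  Incident : ∀ {x y} → Rel (Between x y) ℓ₂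
  Incident (z , _) (z′ , _) = z ≤ z′ ⊎ z′ ≤ z

  -- Every section of rank at least 2 is connected; the section y / x has rank
  -- rank y - rank x - 1.
  StronglyConnected : Set (c ⊔ ℓ₁ ⊔ ℓ₂)
  StronglyConnected =
    ∀ x y → x ≤ y → 3 + toℕ (rank x) ℕ.≤ toℕ (rank y) →
    ∀ (z z′ : Between x y) → Star Incident z z′

  Diamond : Set (c ⊔ ℓ₁ ⊔ ℓ₂)
  Diamond =
    ∀ x y → x ≤ y → 2 + toℕ (rank x) ≡ toℕ (rank y) →
    Σ[ (z₁ , _) ∈ Between x y ] Σ[ (z₂ , _) ∈ Between x y ]
      ¬ z₁ ≈ z₂ × (∀ ((z , _) : Between x y) → z ≈ z₁ ⊎ z ≈ z₂)

------------------------------------------------------------------------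
-- Automorphisms, acting on the right

module _ {n c ℓ₁ ℓ₂} (P : GradedPoset n c ℓ₁ ℓ₂) where
  open GradedPoset P

  record Automorphism : Set (c ⊔ ℓ₁ ⊔ ℓ₂) where
    field
      ⟦_⟧                : Face → Face
      isOrderIsomorphism : IsOrderIsomorphism _≈_ _≈_ _≤_ _≤_ ⟦_⟧

    open IsOrderIsomorphism isOrderIsomorphism public

module _ {n c ℓ₁ ℓ₂} {P : GradedPoset n c ℓ₁ ℓ₂} where
  open GradedPoset P
  open Automorphism

  infixl 8 _·_ _·ᶠ_

  _·_ : Face → Automorphism P → Face
  x · α = ⟦ α ⟧ x

  private
    preimage : (α : Automorphism P) → Face → Face
    preimage α y = proj₁ (surjective α y)

    preimage-· : ∀ α y → preimage α y · α ≈ y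
    preimage-· α y = proj₂ (surjective α y) Eq.refl

  identity : Automorphism P
  identity = record
    { ⟦_⟧                = λ x → x
    ; isOrderIsomorphism = Identity.isOrderIsomorphism _≈_ _≤_ Eq.refl
    }

  compose : Automorphism P → Automorphism P → Automorphism P
  compose α β = record
    { ⟦_⟧                = λ x → x · α · β
    ; isOrderIsomorphism =
        Composition.isOrderIsomorphism Eq.trans
          (isOrderIsomorphism α) (isOrderIsomorphism β)
    }

  invert : Automorphism P → Automorphism P
  invert α = record
    { ⟦_⟧                = preimage α
    ; isOrderIsomorphism = record
      { isOrderMonomorphism = record
        { isOrderHomomorphism = record
          { cong = λ {x} {y} x≈y → injective α
              (Eq.trans (preimage-· α x)
                (Eq.trans x≈y (Eq.sym (preimage-· α y))))
          ; mono = λ {x} {y} x≤y → cancel α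
              (trans (reflexive (preimage-· α x))
                (trans x≤y (reflexive (Eq.sym (preimage-· α y)))))
          }
        ; injective = λ {x} {y} eq →
            Eq.trans (Eq.sym (preimage-· α x))
              (Eq.trans (cong α eq) (preimage-· α y))
        ; cancel    = λ {x} {y} le →
            trans (reflexive (Eq.sym (preimage-· α x)))
              (trans (mono α le) (reflexive (preimage-· α y)))
        }
      ; surjective = λ x → x · α , λ {z} z≈xα →
          injective α (Eq.trans (preimage-· α z) z≈xα)
      }
    }

  private
    -- Induction on m, applied to a face z of rank m - 1 below x: z · α lies
    -- strictly below x · α.
    rank-increasing : ∀ α m x → toℕ (rank x) ≡ m → m ℕ.≤ toℕ (rank (x · α))
    rank-increasing α ℕ.zero    x eq = z≤n
    rank-increasing α (ℕ.suc m) x eq = ℕ.≤∧≢⇒< m≤ m≢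
      where
      m<2+n : m ℕ.< 2 + n
      m<2+n = ℕ.<-trans (ℕ.≤-reflexive (≡.sym eq)) (Fin.toℕ<n (rank x))

      k : Fin (2 + n)
      k = Fin.fromℕ< m<2+n

      k≡m : toℕ k ≡ m
      k≡m = Fin.toℕ-fromℕ< m<2+n

      below : ∃[ z ] rank z ≡ k × least ≤ z × z ≤ x
      below = rank-fill k (least-≤ x)
        (≡.subst (Fin._≤ k) (≡.sym rank-least) z≤n)
        (ℕ.≤-trans (ℕ.≤-reflexive k≡m)
          (ℕ.≤-trans (ℕ.n≤1+n m) (ℕ.≤-reflexive (≡.sym eq))))

      z : Face
      z = proj₁ below

      z≤x : z ≤ x
      z≤x = proj₂ (proj₂ (proj₂ below))

      rank-z : toℕ (rank z) ≡ m
      rank-z = ≡.trans (≡.cong toℕ (proj₁ (proj₂ below))) k≡m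

      m≤zα : m ℕ.≤ toℕ (rank (z · α))
      m≤zα = rank-increasing α m z rank-z

      m≤ : m ℕ.≤ toℕ (rank (x · α))
      m≤ = ℕ.≤-trans m≤zα (rank-mono (mono α z≤x))

      m≢ : m ≢ toℕ (rank (x · α))
      m≢ m≡ = ℕ.1+n≢n
        (≡.trans (≡.sym eq)
          (≡.trans (≡.cong toℕ (≡.sym (rank-cong z≈x))) rank-z))
        where
        zα≈xα : z · α ≈ x · α
        zα≈xα = rank-injective (mono α z≤x)
          (Fin.≤-antisym (rank-mono (mono α z≤x))
            (ℕ.≤-trans (ℕ.≤-reflexive (≡.sym m≡)) m≤zα))

        z≈x : z ≈ x
        z≈x = injective α zα≈xα

  rank-· : ∀ α x → rank (x · α) ≡ rank x
  rank-· α x = Fin.≤-antisym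
    (≡.subst (λ r → rank (x · α) Fin.≤ r)
      (rank-cong (injective α (preimage-· α (x · α))))
      (rank-increasing (invert α) _ (x · α) ≡.refl))
    (rank-increasing α _ x ≡.refl)

  _·ᶠ_ : Flag → Automorphism P → Flag
  Φ ·ᶠ α = record
    { face      = λ k → face Φ k · α
    ; rank-face = λ k → ≡.trans (rank-· α (face Φ k)) (rank-face Φ k)
    ; face-mono = λ j≤k → mono α (face-mono Φ j≤k)
    }

-- The product of α and β is "first α, then β".
Aut : ∀ {n c ℓ₁ ℓ₂} → GradedPoset n c ℓ₁ ℓ₂ → Group (c ⊔ ℓ₁ ⊔ ℓ₂) (c ⊔ ℓ₁)
Aut P = record
  { Carrier = Automorphism P
  ; _≈_     = λ α β → ∀ x → x · α ≈ x · β
  ; _∙_     = compose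
  ; ε       = identity
  ; _⁻¹     = invert
  ; isGroup = record
    { isMonoid = record
      { isSemigroup = record
        { isMagma = record
          { isEquivalence = record
            { refl  = λ x → Eq.refl
            ; sym   = λ α≈β x → Eq.sym (α≈β x)
            ; trans = λ α≈β β≈γ x → Eq.trans (α≈β x) (β≈γ x)
            }
          ; ∙-cong = λ {α} {α′} {β} {β′} α≈α′ β≈β′ x →
              Eq.trans (cong β (α≈α′ x)) (β≈β′ (x · α′))
          }
        ; assoc = λ α β γ x → Eq.refl
        }
      ; identity = (λ α x → Eq.refl) , (λ α x → Eq.refl)
      }
    ; inverse = (λ α y → proj₂ (surjective α y) Eq.refl)
              , (λ α x → injective α (proj₂ (surjective α (x · α)) Eq.refl))
    ; ⁻¹-cong = λ {α} {β} α≈β y → injective β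
        (Eq.trans (Eq.sym (α≈β (y · invert α)))
          (Eq.trans (proj₂ (surjective α y) Eq.refl)
            (Eq.sym (proj₂ (surjective β y) Eq.refl))))
    }
  }
  where
  open GradedPoset P
  open Automorphism

------------------------------------------------------------------------
-- Regular polytopes

record Polytope (n : ℕ) c ℓ₁ ℓ₂ : Set (lsuc (c ⊔ ℓ₁ ⊔ ℓ₂)) where
  field
    gradedPoset : GradedPoset n c ℓ₁ ℓ₂

  open GradedPoset gradedPoset public

  field
    stronglyConnected : StronglyConnected
    diamond           : Diamond

Regular : ∀ {n c ℓ₁ ℓ₂} → Polytope n c ℓ₁ ℓ₂ → Set (c ⊔ ℓ₁ ⊔ ℓ₂)
Regular P = ∀ Φ Φ′ → ∃[ α ] Φ ·ᶠ α ≈ᶠ Φ′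
  where open Polytope P

record DistinguishedGenerators {n c ℓ₁ ℓ₂} (P : Polytope n c ℓ₁ ℓ₂) :
                               Set (c ⊔ ℓ₁ ⊔ ℓ₂) where
  open Polytope P
  field
    baseFlag : Flag
    gen      : Fin n → Automorphism gradedPoset
    adjacent : ∀ i → Adjacent i baseFlag (baseFlag ·ᶠ gen i)
    generate : ∀ α → Generated (Aut gradedPoset) gen α

------------------------------------------------------------------------
-- Quotients and flag actions

-- The faces of P / N are the orbits of the faces of P under N, represented by
-- the faces of P up to being in the same orbit.  The orbit of x is below that
-- of y when some element of the former is below some element of the latter;
-- as N is a group the latter element can be taken to be y.

infixl 6 _/_

_/_ : ∀ {n c ℓ₁ ℓ₂ p} (P : GradedPoset n c ℓ₁ ℓ₂) → Subgroup (Aut P) p →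
      GradedPoset n c (c ⊔ ℓ₁ ⊔ ℓ₂ ⊔ p) (c ⊔ ℓ₁ ⊔ ℓ₂ ⊔ p)
_/_ {n} {c} {ℓ₁} {ℓ₂} {p} P N = record
  { poset = record
    { Carrier        = Face
    ; _≈_            = _≈ᴺ_
    ; _≤_            = _≤ᴺ_
    ; isPartialOrder = record
      { isPreorder = record
        { isEquivalence = record
          { refl  = identity , ε-closed , Eq.refl
          ; sym   = λ (α , α∈N , xα≈y) → invert α , ⁻¹-closed α∈N ,
              injective α (Eq.trans (proj₂ (surjective α _) Eq.refl) (Eq.sym xα≈y))
          ; trans = λ (α , α∈N , xα≈y) (β , β∈N , yβ≈z) →
              compose α β , ∙-closed α∈N β∈N , Eq.trans (cong β xα≈y) yβ≈z
          }
        ; reflexive = λ (α , α∈N , xα≈y) → α , α∈N , reflexive xα≈y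
        ; trans     = λ (α , α∈N , xα≤y) (β , β∈N , yβ≤z) →
            compose α β , ∙-closed α∈N β∈N , trans (mono β xα≤y) yβ≤z
        }
      ; antisym = λ x≤y y≤x → rank-injectiveᴺ x≤y
          (Fin.≤-antisym (rank-monoᴺ x≤y) (rank-monoᴺ y≤x))
      }
    }
  ; rank           = rank
  ; rank-mono      = rank-monoᴺ
  ; rank-injective = rank-injectiveᴺ
  ; rank-fill      = λ {x} k (α , α∈N , xα≤y) x≤k k≤y →
      let (z , rank-z , xα≤z , z≤y) =
            rank-fill k xα≤y (≡.subst (Fin._≤ k) (≡.sym (rank-· α x)) x≤k) k≤y
      in  z , rank-z , (α , α∈N , xα≤z) , (identity , ε-closed , z≤y)
  ; least          = least
  ; least-≤        = λ x → identity , ε-closed , least-≤ x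
  ; rank-least     = rank-least
  ; greatest       = greatest
  ; ≤-greatest     = λ x → identity , ε-closed , ≤-greatest x
  ; rank-greatest  = rank-greatest
  }
  where
  open GradedPoset P
  open Automorphism
  open Subgroup N

  _≈ᴺ_ _≤ᴺ_ : Rel Face (c ⊔ ℓ₁ ⊔ ℓ₂ ⊔ p)
  x ≈ᴺ y = ∃[ α ] Member α × x · α ≈ y
  x ≤ᴺ y = ∃[ α ] Member α × x · α ≤ y

  rank-monoᴺ : ∀ {x y} → x ≤ᴺ y → rank x Fin.≤ rank y
  rank-monoᴺ {x} {y} (α , _ , xα≤y) =
    ≡.subst (Fin._≤ rank y) (rank-· α x) (rank-mono xα≤y)

  rank-injectiveᴺ : ∀ {x y} → x ≤ᴺ y → rank x ≡ rank y → x ≈ᴺ y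
  rank-injectiveᴺ {x} (α , α∈N , xα≤y) eq =
    α , α∈N , rank-injective xα≤y (≡.trans (rank-· α x) eq)

-- Φ ^ s i is the unique flag differing from Φ exactly in its face of rank i:
-- uniqueness is stated positively, as Φ and Φ ^ s i being the only flags that
-- agree with Φ in all other ranks.

record FlagAction {n c ℓ₁ ℓ₂ g ℓ} (Q : GradedPoset n c ℓ₁ ℓ₂) (W : Group g ℓ)
                  (s : Fin n → Group.Carrier W) :
                  Set (c ⊔ ℓ₁ ⊔ ℓ₂ ⊔ g ⊔ ℓ) where
  open GradedPoset Q using (Flag; _≈ᶠ_; AgreeOff; Adjacent)
  open Group W using (Carrier; _≈_; _∙_; ε)

  infixl 8 _^_

  field
    _^_        : Flag → Carrier → Flag
    ^-cong     : ∀ {Φ Φ′ v w} → Φ ≈ᶠ Φ′ → v ≈ w → Φ ^ v ≈ᶠ Φ′ ^ w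
    ^-identity : ∀ Φ → Φ ^ ε ≈ᶠ Φ
    ^-∙        : ∀ Φ v w → Φ ^ (v ∙ w) ≈ᶠ (Φ ^ v) ^ w
    ^-adjacent : ∀ i Φ → Adjacent i Φ (Φ ^ s i)
    ^-unique   : ∀ i Φ Φ′ → AgreeOff i Φ Φ′ → Φ′ ≈ᶠ Φ ⊎ Φ′ ≈ᶠ Φ ^ s i

-- Automorphisms of Q commute with the flag action, because adjacency is
-- preserved by automorphisms and determines the action of each sᵢ.  Hence
-- Ψ ^ (w ψ) = Ψ (w φ) for every word w, the reversal in ψ reflecting that the
-- two actions commute.  So w ψ fixes Ψ, i.e. lies in N, iff w φ fixes Ψ.  Now
-- every flag of P / N lifts to a flag of P, so W is transitive on the flags of
-- P / N, and an automorphism fixing Ψ fixes every flag and hence every face.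
-- Therefore w φ = 1, i.e. w = 1.

module Submission where

open import Defs
open import Level using (Level; _⊔_)
open import Algebra.Bundles using (Group)
open import Algebra.Morphism.Structures using (module GroupMorphisms)
import Algebra.Properties.Group as GroupProperties
open import Data.Fin.Base as Fin using (Fin; zero; suc; inject₁)
import Data.Fin.Properties as Fin
open import Data.List.Base using ([]; _∷_; [_]; _++_; reverse)
open import Data.List.Properties using (unfold-reverse; reverse-involutive)
open import Data.Nat.Base as ℕ using (ℕ; s≤s)
import Data.Nat.Properties as ℕ
open import Data.Product.Base using (Σ-syntax; ∃-syntax; _×_; _,_; proj₁; proj₂)
open import Data.Sum.Base using (inj₁; inj₂)
open import Function.Base using (_∘_)
open import Function.Bundles using (_⇔_; Equivalence)
open import Relation.Binary.Bundles using (Setoid; Preorder)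
open import Relation.Binary.Core using (Rel)
open import Relation.Binary.PropositionalEquality.Core as ≡ using (_≡_)
import Relation.Binary.Reasoning.Setoid as SetoidReasoning
open import Relation.Nullary.Decidable using (yes; no)
open import Relation.Nullary.Negation.Core using (contradiction)
open import Relation.Unary using (Pred; _≐_; _∩_)

-- Group words and generated subgroups.

module _ {g ℓ} (G : Group g ℓ) {I : Set} (a : I → Group.Carrier G) where
  open Group G
  open GroupProperties G using (ε⁻¹≈ε; ⁻¹-involutive; ⁻¹-anti-homo-∙)
  open SetoidReasoning setoid

  eval-++ : ∀ u w → eval G a (u ++ w) ≈ eval G a u ∙ eval G a w
  eval-++ []      w = sym (identityˡ _)
  eval-++ (l ∷ u) w = trans (∙-congˡ (eval-++ u w)) (sym (assoc _ _ _))

  evalReversed-∷ : ∀ l w →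
    evalReversed G a (l ∷ w) ≈ evalReversed G a w ∙ evalLetter G a l
  evalReversed-∷ l w = begin
    eval G a (reverse (l ∷ w))                ≡⟨ ≡.cong (eval G a) (unfold-reverse l w) ⟩
    eval G a (reverse w ++ [ l ])             ≈⟨ eval-++ (reverse w) [ l ] ⟩
    evalReversed G a w ∙ eval G a [ l ]       ≈⟨ ∙-congˡ (identityʳ _) ⟩
    evalReversed G a w ∙ evalLetter G a l     ∎

  eval-letter⁻¹ : ∀ l → ∃[ l′ ] evalLetter G a l′ ≈ evalLetter G a l ⁻¹
  eval-letter⁻¹ (i ⁺) = i ⁻ , refl
  eval-letter⁻¹ (i ⁻) = i ⁺ , sym (⁻¹-involutive _)

  eval-⁻¹ : ∀ w → ∃[ w′ ] eval G a w′ ≈ eval G a w ⁻¹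
  eval-⁻¹ []      = [] , sym ε⁻¹≈ε
  eval-⁻¹ (l ∷ w) =
    let (l′ , l′≈) = eval-letter⁻¹ l
        (w′ , w′≈) = eval-⁻¹ w
    in  w′ ++ [ l′ ] , (begin
      eval G a (w′ ++ [ l′ ])                 ≈⟨ eval-++ w′ [ l′ ] ⟩
      eval G a w′ ∙ eval G a [ l′ ]           ≈⟨ ∙-cong w′≈ (trans (identityʳ _) l′≈) ⟩
      eval G a w ⁻¹ ∙ evalLetter G a l ⁻¹     ≈⟨ ⁻¹-anti-homo-∙ _ _ ⟨
      eval G a (l ∷ w) ⁻¹                     ∎)

  -- Formal inverse letters make the `⁻¹-gen` case possible: the generators are not assumed to have
  -- finite order, so positive words need not suffice.
  Generated⇒eval : ∀ {x} → Generated G a x → ∃[ w ] eval G a w ≈ x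
  Generated⇒eval (generator i) = [ i ⁺ ] , identityʳ _
  Generated⇒eval ε-gen         = [] , refl
  Generated⇒eval (∙-gen p q)   =
    let (u , u≈) = Generated⇒eval p
        (w , w≈) = Generated⇒eval q
    in  u ++ w , trans (eval-++ u w) (∙-cong u≈ w≈)
  Generated⇒eval (⁻¹-gen p)    =
    let (w , w≈)   = Generated⇒eval p
        (w′ , w′≈) = eval-⁻¹ w
    in  w′ , trans w′≈ (⁻¹-cong w≈)
  Generated⇒eval (≈-gen x≈y p) =
    let (w , w≈) = Generated⇒eval p
    in  w , trans w≈ x≈y

  evalLetter-Generated : ∀ l → Generated G a (evalLetter G a l)
  evalLetter-Generated (i ⁺) = generator i
  evalLetter-Generated (i ⁻) = ⁻¹-gen (generator i)

  eval-Generated : ∀ w → Generated G a (eval G a w)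
  eval-Generated []      = ε-gen
  eval-Generated (l ∷ w) = ∙-gen (evalLetter-Generated l) (eval-Generated w)

-- Constructing chains and flags rank by rank.

module _ {a ℓ₁ ℓ₂} (A : Preorder a ℓ₁ ℓ₂) where
  open Preorder A

  -- Induction on `m`, starting the rest of the chain at the element chosen by the first step. The
  -- bound `x₀ ≲ f k` is carried along because monotonicity from index zero in the longer chain
  -- rests on it.
  dependentChain :
    ∀ {q m} (S : Fin (ℕ.suc m) → Pred Carrier q) {x₀} → S zero x₀ →
    (∀ k {x} → S (inject₁ k) x → ∃[ y ] x ≲ y × S (suc k) y) →
    Σ[ f ∈ (Fin (ℕ.suc m) → Carrier) ]
      (∀ k → S k (f k)) × (∀ k → x₀ ≲ f k) × (∀ {j k} → j Fin.≤ k → f j ≲ f k)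
  dependentChain {m = ℕ.zero} S {x₀} s₀ step =
    (λ _ → x₀) , (λ { zero → s₀ }) , (λ _ → refl) , (λ _ → refl)
  dependentChain {m = ℕ.suc m} S {x₀} s₀ step =
    f , S-f , x₀≲f , f-mono
    where
    first = step zero s₀
    rest  = dependentChain (S ∘ suc) (proj₂ (proj₂ first)) (λ k → step (suc k))

    f : Fin (2 ℕ.+ m) → Carrier
    f zero    = x₀
    f (suc k) = proj₁ rest k

    S-f : ∀ k → S k (f k)
    S-f zero    = s₀
    S-f (suc k) = proj₁ (proj₂ rest) k

    x₀≲f : ∀ k → x₀ ≲ f k
    x₀≲f zero    = refl
    x₀≲f (suc k) = trans (proj₁ (proj₂ first)) (proj₁ (proj₂ (proj₂ rest)) k)

    f-mono : ∀ {j k} → j Fin.≤ k → f j ≲ f k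
    f-mono {zero}  {k}     _         = x₀≲f k
    f-mono {suc j} {suc k} (s≤s j≤k) = proj₂ (proj₂ (proj₂ rest)) j≤k

module _ {n c ℓ₁ ℓ₂} (P : GradedPoset n c ℓ₁ ℓ₂) where
  open GradedPoset P

  flagSetoid : Setoid (c ⊔ ℓ₂) ℓ₁
  flagSetoid = record
    { Carrier       = Flag
    ; _≈_           = _≈ᶠ_
    ; isEquivalence = record
      { refl  = λ k → Eq.refl
      ; sym   = λ Φ≈Φ′ k → Eq.sym (Φ≈Φ′ k)
      ; trans = λ Φ≈Φ′ Φ′≈Φ″ k → Eq.trans (Φ≈Φ′ k) (Φ′≈Φ″ k)
      }
    }

  flagBySteps :
    ∀ {q} (S : Fin (2 ℕ.+ n) → Pred Face q) → (∀ k {x} → S k x → rank x ≡ k) →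
    ∀ {x₀} → S zero x₀ →
    (∀ k {x} → S (inject₁ k) x → ∃[ y ] x ≤ y × S (suc k) y) →
    Σ[ F ∈ Flag ] (∀ k → S k (face F k))
  flagBySteps S S-rank s₀ step =
    let (f , S-f , _ , f-mono) = dependentChain preorder S s₀ step
    in  record { face = f ; rank-face = λ k → S-rank k (S-f k) ; face-mono = f-mono }
      , S-f

  -- The flag climbs from `least`, staying below `x` as long as the rank permits. Its face of rank
  -- `rank x` is then below `x` and of the same rank, so `rank-injective` identifies the two.
  flagThrough : ∀ x → Σ[ F ∈ Flag ] face F (rank x) ≈ x
  flagThrough x =
    let (F , S-F) = flagBySteps S (λ _ → proj₁) s₀ step
    in  F , rank-injective (proj₂ (S-F (rank x)) Fin.≤-refl) (rank-face F (rank x))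
    where
    S : Fin (2 ℕ.+ n) → Pred Face ℓ₂
    S k y = rank y ≡ k × (k Fin.≤ rank x → y ≤ x)

    s₀ : S zero least
    s₀ = rank-least , λ _ → least-≤ x

    step : ∀ k {y} → S (inject₁ k) y → ∃[ z ] y ≤ z × S (suc k) z
    step k {y} (rank-y , below) with suc k Fin.≤? rank x
    ... | yes k<x =
      let (z , rank-z , y≤z , z≤x) = rank-fill (suc k) (below k≤x) y≤k k<x
      in  z , y≤z , rank-z , λ _ → z≤x
      where
      inject₁k≤suck : inject₁ k Fin.≤ suc k
      inject₁k≤suck = ℕ.≤-trans (ℕ.≤-reflexive (Fin.toℕ-inject₁ k)) (ℕ.n≤1+n _)
      k≤x = ℕ.≤-trans inject₁k≤suck k<x
      y≤k = ≡.subst (Fin._≤ suc k) (≡.sym rank-y) inject₁k≤suck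
    -- Past the rank of `x` the second condition in `S` is vacuous, and the chain climbs towards
    -- `greatest` instead.
    ... | no k≮x =
      let (z , rank-z , y≤z , _) = rank-fill (suc k) (≤-greatest y) y≤k k≤greatest
      in  z , y≤z , rank-z , λ k<x → contradiction k<x k≮x
      where
      y≤k = ≡.subst (Fin._≤ suc k) (≡.sym rank-y)
        (ℕ.≤-trans (ℕ.≤-reflexive (Fin.toℕ-inject₁ k)) (ℕ.n≤1+n _))
      k≤greatest = ≡.subst (suc k Fin.≤_) (≡.sym rank-greatest) (Fin.≤fromℕ (suc k))

-- Flag actions and their commutation with automorphisms.

module _ {n c ℓ₁ ℓ₂ g ℓ} {Q : GradedPoset n c ℓ₁ ℓ₂} {W : Group g ℓ}
         {s : Fin n → Group.Carrier W} (action : FlagAction Q W s) where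
  open GradedPoset Q
  open Group W using (_∙_; ε; _⁻¹; inverseˡ; inverseʳ)
  private
    module W = Group W
    module 𝓕 = Setoid (flagSetoid Q)
  open FlagAction action
  open SetoidReasoning (flagSetoid Q)

  ^-congˡ : ∀ w {Φ Φ′} → Φ ≈ᶠ Φ′ → Φ ^ w ≈ᶠ Φ′ ^ w
  ^-congˡ w {Φ} {Φ′} Φ≈Φ′ = ^-cong {Φ} {Φ′} {w} {w} Φ≈Φ′ W.refl

  ^-congʳ : ∀ Φ {v w} → v W.≈ w → Φ ^ v ≈ᶠ Φ ^ w
  ^-congʳ Φ = ^-cong {Φ} {Φ} (𝓕.refl {Φ})

  ^-inverseʳ : ∀ Φ w → (Φ ^ w) ^ (w ⁻¹) ≈ᶠ Φ
  ^-inverseʳ Φ w = begin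
    (Φ ^ w) ^ (w ⁻¹)  ≈⟨ ^-∙ Φ w (w ⁻¹) ⟨
    Φ ^ (w ∙ w ⁻¹)    ≈⟨ ^-congʳ Φ (inverseʳ w) ⟩
    Φ ^ ε             ≈⟨ ^-identity Φ ⟩
    Φ                 ∎

  ^-inverseˡ : ∀ Φ w → (Φ ^ (w ⁻¹)) ^ w ≈ᶠ Φ
  ^-inverseˡ Φ w = begin
    (Φ ^ (w ⁻¹)) ^ w  ≈⟨ ^-∙ Φ (w ⁻¹) w ⟨
    Φ ^ (w ⁻¹ ∙ w)    ≈⟨ ^-congʳ Φ (inverseˡ w) ⟩
    Φ ^ ε             ≈⟨ ^-identity Φ ⟩
    Φ                 ∎

  SameOrbit : Rel Flag (ℓ₁ ⊔ g)
  SameOrbit Φ Φ′ = ∃[ w ] Φ ^ w ≈ᶠ Φ′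

  SameOrbit-reflexive : ∀ Φ Φ′ → Φ ≈ᶠ Φ′ → SameOrbit Φ Φ′
  SameOrbit-reflexive Φ Φ′ Φ≈Φ′ = ε , 𝓕.trans {Φ ^ ε} {Φ} {Φ′} (^-identity Φ) Φ≈Φ′

  SameOrbit-sym : ∀ Φ Φ′ → SameOrbit Φ Φ′ → SameOrbit Φ′ Φ
  SameOrbit-sym Φ Φ′ (w , Φw≈Φ′) = w ⁻¹ , (begin
    Φ′ ^ (w ⁻¹)       ≈⟨ ^-congˡ (w ⁻¹) {Φ ^ w} {Φ′} Φw≈Φ′ ⟨
    (Φ ^ w) ^ (w ⁻¹)  ≈⟨ ^-inverseʳ Φ w ⟩
    Φ                 ∎)

  SameOrbit-trans : ∀ Φ Φ′ Φ″ →
    SameOrbit Φ Φ′ → SameOrbit Φ′ Φ″ → SameOrbit Φ Φ″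
  SameOrbit-trans Φ Φ′ Φ″ (v , Φv≈Φ′) (w , Φ′w≈Φ″) = v ∙ w , (begin
    Φ ^ (v ∙ w)   ≈⟨ ^-∙ Φ v w ⟩
    (Φ ^ v) ^ w   ≈⟨ ^-congˡ w {Φ ^ v} {Φ′} Φv≈Φ′ ⟩
    Φ′ ^ w        ≈⟨ Φ′w≈Φ″ ⟩
    Φ″            ∎)

  -- Agreement off one rank, rather than adjacency, is assumed so that this applies to the
  -- projections of adjacent flags without deciding whether they remain distinct.
  AgreeOff⇒SameOrbit : ∀ i Φ Φ′ → AgreeOff i Φ Φ′ → SameOrbit Φ Φ′
  AgreeOff⇒SameOrbit i Φ Φ′ agree with ^-unique i Φ Φ′ agree
  ... | inj₁ Φ′≈Φ  = SameOrbit-reflexive Φ Φ′ (𝓕.sym {Φ′} {Φ} Φ′≈Φ)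
  ... | inj₂ Φ′≈Φs = s i , 𝓕.sym {Φ′} {Φ ^ s i} Φ′≈Φs

  ·ᶠ-cong : ∀ (α : Automorphism Q) {Φ Φ′} → Φ ≈ᶠ Φ′ → Φ ·ᶠ α ≈ᶠ Φ′ ·ᶠ α
  ·ᶠ-cong α Φ≈Φ′ k = Automorphism.cong α (Φ≈Φ′ k)

  -- As `α` preserves agreement off rank `i`, uniqueness leaves two candidates for `(Φ ^ s i) ·ᶠ α`.
  -- It cannot be `Φ ·ᶠ α`, since `α` is injective and `Φ ^ s i` differs from `Φ` at rank `i`.
  ^-gen-·ᶠ : ∀ i Φ (α : Automorphism Q) → (Φ ·ᶠ α) ^ s i ≈ᶠ (Φ ^ s i) ·ᶠ α
  ^-gen-·ᶠ i Φ α
    with ^-unique i (Φ ·ᶠ α) ((Φ ^ s i) ·ᶠ α)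
           (λ k k≢i → Automorphism.cong α (proj₁ (^-adjacent i Φ) k k≢i))
  ... | inj₁ eq = contradiction
        (Automorphism.injective α (Eq.sym (eq (position i)))) (proj₂ (^-adjacent i Φ))
  ... | inj₂ eq = 𝓕.sym {(Φ ^ s i) ·ᶠ α} {(Φ ·ᶠ α) ^ s i} eq

  ^-·ᶠ : ∀ {w} → Generated W s w → ∀ Φ (α : Automorphism Q) →
         (Φ ·ᶠ α) ^ w ≈ᶠ (Φ ^ w) ·ᶠ α
  ^-·ᶠ (generator i) Φ α = ^-gen-·ᶠ i Φ α
  ^-·ᶠ ε-gen Φ α = begin
    (Φ ·ᶠ α) ^ ε  ≈⟨ ^-identity (Φ ·ᶠ α) ⟩
    Φ ·ᶠ α        ≈⟨ ·ᶠ-cong α {Φ ^ ε} {Φ} (^-identity Φ) ⟨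
    (Φ ^ ε) ·ᶠ α  ∎
  ^-·ᶠ (∙-gen {v} {w} p q) Φ α = begin
    (Φ ·ᶠ α) ^ (v ∙ w)    ≈⟨ ^-∙ (Φ ·ᶠ α) v w ⟩
    ((Φ ·ᶠ α) ^ v) ^ w    ≈⟨ ^-congˡ w {(Φ ·ᶠ α) ^ v} {(Φ ^ v) ·ᶠ α} (^-·ᶠ p Φ α) ⟩
    ((Φ ^ v) ·ᶠ α) ^ w    ≈⟨ ^-·ᶠ q (Φ ^ v) α ⟩
    ((Φ ^ v) ^ w) ·ᶠ α    ≈⟨ ·ᶠ-cong α {Φ ^ (v ∙ w)} {(Φ ^ v) ^ w} (^-∙ Φ v w) ⟨
    (Φ ^ (v ∙ w)) ·ᶠ α    ∎
  -- Writing `Φ` as `Θ ^ w` turns the claim for `w ⁻¹` into the one for `w` at `Θ`.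
  ^-·ᶠ (⁻¹-gen {w} p) Φ α = begin
    (Φ ·ᶠ α) ^ (w ⁻¹)             ≈⟨ ^-congˡ (w ⁻¹) {(Θ ^ w) ·ᶠ α} {Φ ·ᶠ α}
                                       (·ᶠ-cong α {Θ ^ w} {Φ} (^-inverseˡ Φ w)) ⟨
    ((Θ ^ w) ·ᶠ α) ^ (w ⁻¹)       ≈⟨ ^-congˡ (w ⁻¹) {(Θ ·ᶠ α) ^ w} {(Θ ^ w) ·ᶠ α}
                                       (^-·ᶠ p Θ α) ⟨
    ((Θ ·ᶠ α) ^ w) ^ (w ⁻¹)       ≈⟨ ^-inverseʳ (Θ ·ᶠ α) w ⟩
    Θ ·ᶠ α                        ∎
    where Θ = Φ ^ (w ⁻¹)
  ^-·ᶠ (≈-gen {v} {w} v≈w p) Φ α = begin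
    (Φ ·ᶠ α) ^ w    ≈⟨ ^-congʳ (Φ ·ᶠ α) v≈w ⟨
    (Φ ·ᶠ α) ^ v    ≈⟨ ^-·ᶠ p Φ α ⟩
    (Φ ^ v) ·ᶠ α    ≈⟨ ·ᶠ-cong α {Φ ^ v} {Φ ^ w} (^-congʳ Φ v≈w) ⟩
    (Φ ^ w) ·ᶠ α    ∎

  module _ (generate : ∀ w → Generated W s w) (Ψ : Flag) where

    -- Since `v` acts past `β`, the automorphism belonging to the second factor `v` comes first in
    -- the product. This is the source of the reversal in ψ.
    ^≈·ᶠ-∙ : ∀ u v α β → Ψ ^ u ≈ᶠ Ψ ·ᶠ β → Ψ ^ v ≈ᶠ Ψ ·ᶠ α →
             Ψ ^ (u ∙ v) ≈ᶠ Ψ ·ᶠ compose α β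
    ^≈·ᶠ-∙ u v α β Ψu≈Ψβ Ψv≈Ψα = begin
      Ψ ^ (u ∙ v)           ≈⟨ ^-∙ Ψ u v ⟩
      (Ψ ^ u) ^ v           ≈⟨ ^-congˡ v {Ψ ^ u} {Ψ ·ᶠ β} Ψu≈Ψβ ⟩
      (Ψ ·ᶠ β) ^ v          ≈⟨ ^-·ᶠ (generate v) Ψ β ⟩
      (Ψ ^ v) ·ᶠ β          ≈⟨ ·ᶠ-cong β {Ψ ^ v} {Ψ ·ᶠ α} Ψv≈Ψα ⟩
      Ψ ·ᶠ compose α β      ∎

    -- Both sides become `Ψ` after applying the injective map `α`.
    ^≈·ᶠ-⁻¹ : ∀ v α → Ψ ^ v ≈ᶠ Ψ ·ᶠ α → Ψ ^ (v ⁻¹) ≈ᶠ Ψ ·ᶠ invert α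
    ^≈·ᶠ-⁻¹ v α Ψv≈Ψα k = Automorphism.injective α (same-image k)
      where
      same-image : (Ψ ^ (v ⁻¹)) ·ᶠ α ≈ᶠ (Ψ ·ᶠ invert α) ·ᶠ α
      same-image = begin
        (Ψ ^ (v ⁻¹)) ·ᶠ α      ≈⟨ ^-·ᶠ (generate (v ⁻¹)) Ψ α ⟨
        (Ψ ·ᶠ α) ^ (v ⁻¹)      ≈⟨ ^-congˡ (v ⁻¹) {Ψ ^ v} {Ψ ·ᶠ α} Ψv≈Ψα ⟨
        (Ψ ^ v) ^ (v ⁻¹)       ≈⟨ ^-inverseʳ Ψ v ⟩
        Ψ                      ≈⟨ (λ k → Group.inverseˡ (Aut Q) α (face Ψ k)) ⟨
        (Ψ ·ᶠ invert α) ·ᶠ α   ∎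

    -- By commutation, the flags fixed by `α` form a union of orbits of the flag action.
    fixes-SameOrbit : ∀ (α : Automorphism Q) Φ → Ψ ·ᶠ α ≈ᶠ Ψ → SameOrbit Ψ Φ → Φ ·ᶠ α ≈ᶠ Φ
    fixes-SameOrbit α Φ Ψα≈Ψ (w , Ψw≈Φ) = begin
      Φ ·ᶠ α          ≈⟨ ·ᶠ-cong α {Ψ ^ w} {Φ} Ψw≈Φ ⟨
      (Ψ ^ w) ·ᶠ α    ≈⟨ ^-·ᶠ (generate w) Ψ α ⟨
      (Ψ ·ᶠ α) ^ w    ≈⟨ ^-congˡ w {Ψ ·ᶠ α} {Ψ} Ψα≈Ψ ⟩
      Ψ ^ w           ≈⟨ Ψw≈Φ ⟩
      Φ               ∎

-- Projecting flags to the quotient and lifting them back.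

module _ {n c ℓ₁ ℓ₂ p} (P : GradedPoset n c ℓ₁ ℓ₂) (N : Subgroup (Aut P) p) where
  open GradedPoset P
  open Subgroup N
  private
    module Q = GradedPoset (P / N)

  ≈⇒≈ᴺ : ∀ {x y} → x ≈ y → x Q.≈ y
  ≈⇒≈ᴺ x≈y = identity , ε-closed , x≈y

  project : Flag → Q.Flag
  project F = record
    { face      = face F
    ; rank-face = rank-face F
    ; face-mono = λ j≤k → identity , ε-closed , face-mono F j≤k
    }

  -- Replacing each face in turn by a member of its orbit above the previous
  -- choice, only the incidences of consecutive ranks need to be lifted.
  liftFlag : ∀ Φ → Σ[ F ∈ Flag ] Φ Q.≈ᶠ project F
  liftFlag Φ = flagBySteps P (λ k x → Q.face Φ k Q.≈ x)
    (λ k Φk≈x → ≡.trans (≡.sym (Q.rank-cong Φk≈x)) (Q.rank-face Φ k))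
    (Q.Eq.refl {Q.face Φ zero})
    step
    where
    step : ∀ k {x} → Q.face Φ (inject₁ k) Q.≈ x →
           ∃[ y ] x ≤ y × Q.face Φ (suc k) Q.≈ y
    step k {x} Φk≈x =
      let (α , α∈N , xα≤Φk′) = Q.trans (Q.reflexive (Q.Eq.sym {y = x} Φk≈x))
                                 (Q.face-mono Φ inject₁k≤suck)
          -- The next face of the quotient flag is pulled back along the same `α` that brings `x`
          -- below it, so `cancel` puts `x` below `y`.
          y , yα≈Φk′ = Automorphism.surjective α (Q.face Φ (suc k))
      in  y
        , Automorphism.cancel α (trans xα≤Φk′ (reflexive (Eq.sym (yα≈Φk′ Eq.refl))))
        , invert α , ⁻¹-closed α∈N , Eq.refl
      where
      inject₁k≤suck : inject₁ k Fin.≤ suc k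
      inject₁k≤suck = ℕ.≤-trans (ℕ.≤-reflexive (Fin.toℕ-inject₁ k)) (ℕ.n≤1+n _)

-- Transitivity on the flags of the quotient.

module _ {n c ℓ₁ ℓ₂ p} (P : Polytope n c ℓ₁ ℓ₂) (regular : Regular P)
         (s : DistinguishedGenerators P)
         (N : Subgroup (Aut (Polytope.gradedPoset P)) p)
         (action : FlagAction (Polytope.gradedPoset P / N)
                     (Aut (Polytope.gradedPoset P)) (DistinguishedGenerators.gen s))
         where
  open Polytope P
  open DistinguishedGenerators s
  private
    W = Aut gradedPoset
    module W = Group W
    module Q = GradedPoset (gradedPoset / N)

    π : Flag → Q.Flag
    π = project gradedPoset N

    _∼ᵂ_ : Rel Q.Flag _
    _∼ᵂ_ = SameOrbit action

  -- Adjacency is known only at `baseFlag`, so generators enter on the left: translating by `g`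
  -- carries agreement of `baseFlag` and `baseFlag ·ᶠ gen i` to their images. The element `g` is
  -- arbitrary because the product case uses it at `compose y g`.
  baseFlag-∼ᵂ : ∀ {h} → Generated W gen h → ∀ g →
                π (baseFlag ·ᶠ g) ∼ᵂ π (baseFlag ·ᶠ compose h g)
  baseFlag-∼ᵂ (generator i) g =
    AgreeOff⇒SameOrbit action i (π (baseFlag ·ᶠ g)) (π (baseFlag ·ᶠ compose (gen i) g))
      (λ k k≢i → ≈⇒≈ᴺ gradedPoset N
        (Automorphism.cong g (proj₁ (adjacent i) k k≢i)))
  baseFlag-∼ᵂ ε-gen g =
    SameOrbit-reflexive action (π (baseFlag ·ᶠ g)) (π (baseFlag ·ᶠ compose identity g))
      (λ k → ≈⇒≈ᴺ gradedPoset N Eq.refl)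
  baseFlag-∼ᵂ (∙-gen {x} {y} p q) g =
    SameOrbit-trans action (π (baseFlag ·ᶠ g)) (π (baseFlag ·ᶠ compose y g))
      (π (baseFlag ·ᶠ compose (compose x y) g))
      (baseFlag-∼ᵂ q g) (baseFlag-∼ᵂ p (compose y g))
  -- At `compose (invert x) g` the induction hypothesis for `x` cancels the inverse and leads back
  -- to `g`.
  baseFlag-∼ᵂ (⁻¹-gen {x} p) g =
    SameOrbit-sym action Φ (π (baseFlag ·ᶠ g))
      (SameOrbit-trans action Φ (π (baseFlag ·ᶠ compose x (compose (invert x) g)))
        (π (baseFlag ·ᶠ g))
        (baseFlag-∼ᵂ p (compose (invert x) g))
        (SameOrbit-reflexive action
          (π (baseFlag ·ᶠ compose x (compose (invert x) g))) (π (baseFlag ·ᶠ g))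
          (λ k → ≈⇒≈ᴺ gradedPoset N
            (Automorphism.cong g (W.inverseʳ x (face baseFlag k))))))
    where Φ = π (baseFlag ·ᶠ compose (invert x) g)
  baseFlag-∼ᵂ (≈-gen {x} {y} x≈y p) g =
    SameOrbit-trans action (π (baseFlag ·ᶠ g)) (π (baseFlag ·ᶠ compose x g))
      (π (baseFlag ·ᶠ compose y g))
      (baseFlag-∼ᵂ p g)
      (SameOrbit-reflexive action
        (π (baseFlag ·ᶠ compose x g)) (π (baseFlag ·ᶠ compose y g))
        (λ k → ≈⇒≈ᴺ gradedPoset N (Automorphism.cong g (x≈y (face baseFlag k)))))

  -- baseFlag ·ᶠ identity is not definitionally baseFlag: the proofs rank-face differ.
  baseFlag-∼ᵂ-flag : ∀ Φ → π (baseFlag ·ᶠ identity) ∼ᵂ Φ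
  baseFlag-∼ᵂ-flag Φ =
    let (F , Φ≈πF) = liftFlag gradedPoset N Φ
        (α , Bα≈F) = regular baseFlag F
        Bα         = π (baseFlag ·ᶠ compose α identity)
    in  SameOrbit-trans action (π (baseFlag ·ᶠ identity)) Bα Φ
          (baseFlag-∼ᵂ (generate α) identity)
          (SameOrbit-reflexive action Bα Φ
            (λ k → Q.Eq.trans (≈⇒≈ᴺ gradedPoset N (Bα≈F k)) (Q.Eq.sym (Φ≈πF k))))

  -- Both flags are joined to the projected base flag: each lifts to `P`, where regularity carries
  -- the base flag to the lift.
  flagAction-transitive : ∀ Φ Φ′ → Φ ∼ᵂ Φ′
  flagAction-transitive Φ Φ′ =
    SameOrbit-trans action Φ (π (baseFlag ·ᶠ identity)) Φ′
      (SameOrbit-sym action (π (baseFlag ·ᶠ identity)) Φ (baseFlag-∼ᵂ-flag Φ))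
      (baseFlag-∼ᵂ-flag Φ′)

  -- Each face lies on some flag, and that flag is fixed because it is in the orbit of `Ψ`.
  fixesFlag⇒identity : ∀ Ψ (α : Automorphism (gradedPoset / N)) → Ψ ·ᶠ α Q.≈ᶠ Ψ →
                       ∀ x → x · α Q.≈ x
  fixesFlag⇒identity Ψ α Ψα≈Ψ x =
    let (F , Fx≈x) = flagThrough (gradedPoset / N) x
    in  Q.Eq.trans (Automorphism.cong α (Q.Eq.sym Fx≈x))
          (Q.Eq.trans
            (fixes-SameOrbit action generate Ψ α F Ψα≈Ψ (flagAction-transitive Ψ F)
              (Q.rank x))
            Fx≈x)

-- Words in the `ν i` that stabilize the base flag of the quotient.

theorem4 :
  ∀ {c ℓ₁ ℓ₂ p c′ ℓ₁′ ℓ₂′ : Level} {n d : ℕ}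
  (P : Polytope n c ℓ₁ ℓ₂) → Regular P → (s : DistinguishedGenerators P) →
  let W = Aut (Polytope.gradedPoset P) in
  (N : Subgroup W p) →
  let Q = Polytope.gradedPoset P / N in
  (action : FlagAction Q W (DistinguishedGenerators.gen s)) →
  let open GradedPoset Q using (_≈ᶠ_)
      open FlagAction action using (_^_)
  in
  (Ψ : GradedPoset.Flag Q) → (∀ v → Subgroup.Member N v ⇔ Ψ ^ v ≈ᶠ Ψ) →
  (R : Polytope d c′ ℓ₁′ ℓ₂′) → Regular R → (r : DistinguishedGenerators R) →
  let Γ = Aut (Polytope.gradedPoset R)
      ρ = DistinguishedGenerators.gen r
      open GroupMorphisms (Group.rawGroup Γ) (Group.rawGroup (Aut Q)) using (IsGroupIsomorphism)
  in
  (φ : Group.Carrier Γ → Automorphism Q) → IsGroupIsomorphism φ →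
  (ν : Fin d → Group.Carrier W) → (∀ i → Ψ ^ ν i ≈ᶠ Ψ ·ᶠ φ (ρ i)) →
  let V = Generated W ν
      _ψ = evalReversed W ν
  in
  (Subgroup.Member N ∩ V) ≐
    (λ v → ∃[ w ] Group._≈_ Γ (eval Γ ρ w) (Group.ε Γ) × Group._≈_ W (w ψ) v)
theorem4 P regP s N action Ψ stab R _ r φ iso ν Ψν≈Ψφρ = to , from
  where
  open Polytope P using (gradedPoset)
  open DistinguishedGenerators s using (gen; generate)

  W = Aut gradedPoset
  Q = gradedPoset / N
  Γ = Aut (Polytope.gradedPoset R)
  ρ = DistinguishedGenerators.gen r

  module W = Group W
  module Γ = Group Γ
  module AutQ = Group (Aut Q)
  module 𝓕 = Setoid (flagSetoid Q)
  open GradedPoset Q using (_≈ᶠ_; face)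
  open FlagAction action using (_^_; ^-identity)
  open SetoidReasoning (flagSetoid Q)
  open GroupMorphisms Γ.rawGroup AutQ.rawGroup using (module IsGroupIsomorphism)
  open IsGroupIsomorphism iso using (⟦⟧-cong; ∙-homo; ε-homo; ⁻¹-homo; injective)

  Ψ·-cong : ∀ α β → α AutQ.≈ β → Ψ ·ᶠ α ≈ᶠ Ψ ·ᶠ β
  Ψ·-cong α β α≈β k = α≈β (face Ψ k)

  letter : ∀ l → Ψ ^ evalLetter W ν l ≈ᶠ Ψ ·ᶠ φ (evalLetter Γ ρ l)
  letter (i ⁺) = Ψν≈Ψφρ i
  letter (i ⁻) = begin
    Ψ ^ (ν i W.⁻¹)          ≈⟨ ^≈·ᶠ-⁻¹ action generate Ψ (ν i) (φ (ρ i)) (Ψν≈Ψφρ i) ⟩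
    Ψ ·ᶠ invert (φ (ρ i))   ≈⟨ Ψ·-cong (φ (ρ i Γ.⁻¹)) (invert (φ (ρ i))) (⁻¹-homo (ρ i)) ⟨
    Ψ ·ᶠ φ (ρ i Γ.⁻¹)       ∎

  -- `evalReversed` moves the head letter to the end, which is the order in which `^≈·ᶠ-∙` combines
  -- the two actions.
  word : ∀ w → Ψ ^ evalReversed W ν w ≈ᶠ Ψ ·ᶠ φ (eval Γ ρ w)
  word []      = begin
    Ψ ^ W.ε        ≈⟨ ^-identity Ψ ⟩
    Ψ              ≈⟨ Ψ·-cong (φ Γ.ε) identity ε-homo ⟨
    Ψ ·ᶠ φ Γ.ε     ∎
  word (l ∷ w) = begin
    Ψ ^ evalReversed W ν (l ∷ w)
      ≈⟨ ^-congʳ action Ψ {evalReversed W ν (l ∷ w)} {v W.∙ a} (evalReversed-∷ W ν l w) ⟩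
    Ψ ^ (v W.∙ a)
      ≈⟨ ^≈·ᶠ-∙ action generate Ψ v a (φ b) (φ u) (word w) (letter l) ⟩
    Ψ ·ᶠ compose (φ b) (φ u)
      ≈⟨ Ψ·-cong (φ (b Γ.∙ u)) (compose (φ b) (φ u)) (∙-homo b u) ⟨
    Ψ ·ᶠ φ (b Γ.∙ u) ∎
    where
    v = evalReversed W ν w
    a = evalLetter W ν l
    u = eval Γ ρ w
    b = evalLetter Γ ρ l

  to : ∀ {v} → Subgroup.Member N v × Generated W ν v →
       ∃[ w ] eval Γ ρ w Γ.≈ Γ.ε × evalReversed W ν w W.≈ v
  to {v} (v∈N , v∈V) =
    let (u , u≈v) = Generated⇒eval W ν v∈V
        -- The word `u` spells `v` from left to right; it is reversed beforehand because ψ reverses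
        -- again.
        w = reverse u
        wψ≈v : evalReversed W ν w W.≈ v
        wψ≈v = ≡.subst (λ u′ → eval W ν u′ W.≈ v) (≡.sym (reverse-involutive u)) u≈v
        fixes : Ψ ·ᶠ φ (eval Γ ρ w) ≈ᶠ Ψ
        fixes = begin
          Ψ ·ᶠ φ (eval Γ ρ w)       ≈⟨ word w ⟨
          Ψ ^ evalReversed W ν w    ≈⟨ ^-congʳ action Ψ {evalReversed W ν w} {v} wψ≈v ⟩
          Ψ ^ v                     ≈⟨ Equivalence.to (stab v) v∈N ⟩
          Ψ                         ∎
        φw≈ε = fixesFlag⇒identity P regP s N action Ψ (φ (eval Γ ρ w)) fixes
    in  w
      , injective {eval Γ ρ w} {Γ.ε}
          (AutQ.trans {φ (eval Γ ρ w)} {identity} {φ Γ.ε} φw≈ε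
            (AutQ.sym {φ Γ.ε} {identity} ε-homo))
      , wψ≈v

  from : ∀ {v} → ∃[ w ] eval Γ ρ w Γ.≈ Γ.ε × evalReversed W ν w W.≈ v →
         Subgroup.Member N v × Generated W ν v
  from {v} (w , w≈ε , wψ≈v) =
      Subgroup.resp N wψ≈v (Equivalence.from (stab (evalReversed W ν w)) fixes)
    , ≈-gen wψ≈v (eval-Generated W ν (reverse w))
    where
    fixes : Ψ ^ evalReversed W ν w ≈ᶠ Ψ
    fixes = begin
      Ψ ^ evalReversed W ν w   ≈⟨ word w ⟩
      Ψ ·ᶠ φ (eval Γ ρ w)      ≈⟨ Ψ·-cong (φ (eval Γ ρ w)) (φ Γ.ε) (⟦⟧-cong w≈ε) ⟩
      Ψ ·ᶠ φ Γ.ε               ≈⟨ Ψ·-cong (φ Γ.ε) identity ε-homo ⟩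
      Ψ                        ∎
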